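{- Let $n\ge 1$. A permutation $\sigma\in\mathfrak{S}_n$ is a web permutation if and only if each cycle of $\sigma$ (fixed points being cycles of length 1) is an André cycle.
   Context: **Web permutations.** The cells of the $n\times n$ grid are indexed by $(i,j)$ with $1\le i,j\le n$ ($i$ is the $x$-coordinate, $j$ the $y$-coordinate). For $\sigma\in\mathfrak{S}_n$, a cell $(i,j)$ is a crossing of $\sigma$ if $\sigma(i)<j$ and $i<\sigma^{ -1}(j)$; $\mathrm{Cr}(\sigma)$ is the set of crossings. A grid configuration is $G(\sigma,E)$, determined by a pair $(\sigma,E)$ with $\sigma\in\mathfrak{S}_n$ and $E\subseteq\mathrm{Cr}(\sigma)$; its remaining crossings are the elements of $\mathrm{Cr}(\sigma)\setminus E$. Order cells by $(x,y)\succeq(x',y')$ iff $x\le x'$ and $y\ge y'$. If $c=(i,j)$ is a $\succeq$-maximal remaining crossing of $G(\sigma,E)$, resolving $c$ produces two grid configurations: $G(\sigma,E\cup\{c\})$ (smoothing) and $G(\sigma',E)$ (switching), where $\sigma'(i)=j$, $\sigma'(\sigma^{ -1}(j))=\sigma(i)$, and $\sigma'(k)=\sigma(k)$ for $k\ne i,\sigma^{ -1}(j)$ (one has $E\subseteq\mathrm{Cr}(\sigma')$). Start from $G(\mathrm{id},\emptyset)$ and repeatedly replace each grid configuration having a remaining crossing by the two obtained by resolving a maximal one, until all are of the form $G(\sigma,\mathrm{Cr}(\sigma))$. The permutations $\sigma$ occurring are the web permutations of $[n]$ (the result does not depend on the choices of maximal crossings). **André permutations and cycles.** Here permutations are words of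 distinct positive integers. André permutations are defined recursively: the empty word and every one-letter word are André permutations; a word $w=w_1\cdots w_m$ with $m\ge 2$ and smallest letter $w_k$ is an André permutation if both $w_1\cdots w_{k-1}$ and $w_{k+1}\cdots w_m$ are André permutations and $\max\{w_1,\dots,w_{k-1}\}<\max\{w_{k+1},\dots,w_m\}$ (with $\max\emptyset=-\infty$). A cycle $C=(a_1,\dots,a_k)$ of distinct positive integers, written with $a_1=\min\{a_1,\dots,a_k\}$, is an André cycle if the word $a_2\cdots a_k$ is an André permutation. Cycle notation $(a_1,\dots,a_k)$ means $a_i\mapsto a_{i+1}$, $a_k\mapsto a_1$. -}

module Defs where

open import Data.Fin.Base using (Fin; toℕ; _≤_; _<_; _≥_)
open import Data.Fin.Permutation using (Permutation′; _⟨$⟩ʳ_; _⟨$⟩ˡ_; _≈_; id)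
open import Data.List.Base using (List; []; _∷_; _++_; _∷ʳ_; map)
open import Data.List.Extrema.Nat using (max)
open import Data.List.Relation.Unary.All using (All)
open import Data.List.Relation.Unary.Unique.Propositional using (Unique)
open import Data.Nat.Base as ℕ using (ℕ; suc)
open import Data.Product.Base using (_×_; _,_; proj₁; proj₂; ∃-syntax)
open import Level using (0ℓ)
open import Relation.Binary.Construct.Closure.ReflexiveTransitive using (Star)
open import Relation.Binary.PropositionalEquality using (_≡_; _≢_)
open import Relation.Unary using (Pred; _∈_; _⊆_; _≐_; _∪_; ∅; ｛_｝; _∖_)

private
  variable
    n : ℕ

-- The set {1,…,n} is represented by Fin n, with i : Fin n standing for
-- 1 + toℕ i; the shift preserves the order.  A cell is (x-coordinate ,
-- y-coordinate).

Cell : ℕ → Set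
Cell n = Fin n × Fin n

Cr : Permutation′ n → Pred (Cell n) 0ℓ
Cr σ (i , j) = (σ ⟨$⟩ʳ i < j) × (i < σ ⟨$⟩ˡ j)

_⪰_ : Cell n → Cell n → Set
(x , y) ⪰ (x′ , y′) = (x ≤ x′) × (y ≥ y′)

record GridConfig (n : ℕ) : Set₁ where
  field
    perm : Permutation′ n
    E    : Pred (Cell n) 0ℓ
    E⊆Cr : E ⊆ Cr perm

  Remaining : Pred (Cell n) 0ℓ
  Remaining = Cr perm ∖ E

open GridConfig public

MaximalRemaining : GridConfig n → Cell n → Set
MaximalRemaining G c =
  c ∈ Remaining G × (∀ d → d ∈ Remaining G → d ⪰ c → d ≡ c)

-- Permutations and sets of cells are compared extensionally, so the results
-- of a smoothing or a switching are given as relations rather than functions.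

record IsSmoothing (G : GridConfig n) (c : Cell n) (H : GridConfig n) : Set where
  field
    perm-same : perm H ≈ perm G
    E-extend  : E H ≐ (E G ∪ ｛ c ｝)

-- There need not be a switching for an arbitrary G, since E G ⊆ Cr σ′ can
-- fail; it holds for every G reachable from the initial configuration.

record IsSwitching (G : GridConfig n) (c : Cell n) (H : GridConfig n) : Set where
  private
    i  = proj₁ c
    j  = proj₂ c
    σ  = perm G
    σ′ = perm H
  field
    at-i      : σ′ ⟨$⟩ʳ i ≡ j
    at-σ⁻¹j   : σ′ ⟨$⟩ʳ (σ ⟨$⟩ˡ j) ≡ σ ⟨$⟩ʳ i
    elsewhere : ∀ k → k ≢ i → k ≢ σ ⟨$⟩ˡ j → σ′ ⟨$⟩ʳ k ≡ σ ⟨$⟩ʳ k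
    E-same    : E H ≐ E G

data _⟶_ (G H : GridConfig n) : Set where
  smooth : ∀ c → MaximalRemaining G c → IsSmoothing G c H → G ⟶ H
  switch : ∀ c → MaximalRemaining G c → IsSwitching G c H → G ⟶ H

initial : GridConfig n
initial = record { perm = id ; E = ∅ ; E⊆Cr = λ () }

-- σ occurs among the final configurations G(σ , Cr σ) of the resolution
-- process.  A final configuration is reached along a branch of resolutions,
-- each at an arbitrary maximal remaining crossing.

IsWeb : Permutation′ n → Set₁
IsWeb {n} σ =
  ∃[ G ] Star _⟶_ (initial {n}) G × perm G ≈ σ × E G ≐ Cr (perm G)

-- In a split, every letter of u and v exceeds k and so is positive; hence
-- max 0 is the maximum, with 0 in the role of max ∅ = -∞.  The inequality of
-- maxima forces v to be nonempty, so a split word has at least two letters.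

data André : List ℕ → Set where
  empty  : André []
  single : ∀ a → André (a ∷ [])
  split  : ∀ {w} u k v → w ≡ u ++ k ∷ v →
           All (k ℕ.<_) u → All (k ℕ.<_) v →
           André u → André v →
           max 0 u ℕ.< max 0 v →
           André w

-- A cycle (a₁,…,aₖ) of σ with first = a₁ and rest = a₂ ⋯ aₖ, written from its
-- minimum.  The field maps says (σ a₁,…,σ aₖ) = (a₂,…,aₖ,a₁).

record Cycle (σ : Permutation′ n) : Set where
  field
    first    : Fin n
    rest     : List (Fin n)
    distinct : Unique (first ∷ rest)
    maps     : map (σ ⟨$⟩ʳ_) (first ∷ rest) ≡ rest ∷ʳ first
    minimal  : All (first ≤_) rest

IsAndréCycle : {σ : Permutation′ n} → Cycle σ → Set
IsAndréCycle C = André (map (λ i → suc (toℕ i)) (Cycle.rest C))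

{-# OPTIONS --safe #-}
-- Write an André cycle as a word from its smallest to its largest letter.  The
-- concatenation of two disjoint such words, with both the first and the last
-- letter increasing, is again one (André-++), and every such word with at least
-- two letters is cut after its second largest letter into two such words
-- (André-cut).
--
-- Along any sequence of resolutions, every cycle is André, and for a remaining
-- crossing (i , j) both i and σ⁻¹(j) are the largest elements of their cycles.
-- So switching (i , j) concatenates the words ending with i and with σ⁻¹(j).
--
-- Conversely, resolve column by column, from the left.  Just before column i,
-- every k ≥ i is the largest element of its cycle.  If i is still the largest
-- element of its cycle in the target after column i, smooth the whole column;
-- otherwise the cycle must be cut after i, which undoes one switching.

module Submission where

open import Data.Empty using (⊥)
open import Data.Fin.Base as Fin using (Fin; toℕ)
open import Data.Fin.Permutation
  using (Permutation′; _⟨$⟩ʳ_; _⟨$⟩ˡ_; _≈_; _∘ₚ_; transpose; inverseˡ; inverseʳ)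
import Data.Fin.Properties as Finₚ
open import Data.List.Base
  using (List; []; _∷_; _++_; _∷ʳ_; [_]; map; initLast; _∷ʳ′_)
import Data.List.Extrema as ListExtrema
open import Data.List.Extrema.Nat using (max; max≤v⁺; max[xs]<max[ys]⁺; xs≤max)
open import Data.List.Membership.Propositional using (_∈_; _∉_; lose)
open import Data.List.Membership.Propositional.Properties
  using (∈-map⁺; ∈-++⁺ˡ; ∈-++⁺ʳ; ∈-++⁻; ∈-∃++)
open import Data.List.Properties
  using (∷-injective; ∷-injectiveˡ; ∷-injectiveʳ; ∷ʳ-injective; ++-assoc; map-++;
         ++-identityˡ-unique; ++-conicalʳ)
open import Data.List.Relation.Unary.All as All using (All; []; _∷_)
import Data.List.Relation.Unary.All.Properties as Allₚ
open import Data.List.Relation.Unary.AllPairs as AllPairs using ([]; _∷_)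
open import Data.List.Relation.Unary.Any using (here; there)
open import Data.List.Relation.Unary.Unique.Propositional using (Unique)
open import Data.Nat.Base as ℕ using (ℕ; zero; suc; _≤_; z≤n; s≤s)
import Data.Nat.Properties as ℕₚ
open import Data.Product.Base using (Σ; ∃-syntax; _×_; _,_; proj₁; proj₂)
open import Data.Sum.Base using (_⊎_; inj₁; inj₂; [_,_]′)
open import Function.Base using (_∘_)
open import Function.Bundles using (_⇔_; mk⇔)
open import Level using (0ℓ)
open import Relation.Binary.Construct.Closure.ReflexiveTransitive using (Star; ε; _◅_; _◅◅_)
open import Relation.Binary.Definitions using (tri<; tri≈; tri>)
open import Relation.Binary.PropositionalEquality
  using (_≡_; _≢_; refl; sym; trans; cong; cong₂; subst; subst₂)
open import Relation.Nullary using (¬_; yes; no; contradiction)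
open import Relation.Nullary.Decidable using (_×-dec_; dec-true; dec-false)
open import Relation.Unary using (_⊆_; _≐_; _∩_; _∪_; ｛_｝; Pred) renaming (_∈_ to _∈ᵖ_)
open import Defs

private
  module Extrema {n} = ListExtrema (Finₚ.≤-totalOrder n)
  variable
    n : ℕ
    A : Set

-- André words: joining and cutting.

++-∷-compare : ∀ (u : List A) {x v} p {y q} → u ++ x ∷ v ≡ p ++ y ∷ q →
               (∃[ s ] p ≡ u ++ x ∷ s × v ≡ s ++ y ∷ q)
               ⊎ (u ≡ p × x ≡ y × v ≡ q)
               ⊎ (∃[ s ] u ≡ p ++ y ∷ s × q ≡ s ++ x ∷ v)
++-∷-compare [] [] refl = inj₂ (inj₁ (refl , refl , refl))
++-∷-compare [] (_ ∷ p) refl = inj₁ (p , refl , refl)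
++-∷-compare (_ ∷ u) [] refl = inj₂ (inj₂ (u , refl , refl))
++-∷-compare (_ ∷ u) (_ ∷ p) eq with refl , eq′ ← ∷-injective eq
  with ++-∷-compare u p eq′
... | inj₁ (s , refl , refl) = inj₁ (s , refl , refl)
... | inj₂ (inj₁ (refl , e)) = inj₂ (inj₁ (refl , e))
... | inj₂ (inj₂ (s , refl , refl)) = inj₂ (inj₂ (s , refl , refl))

init-prefix : ∀ (q : List A) {b} s {x v} → q ∷ʳ b ≡ s ++ x ∷ v →
              ∀ {z} → z ∈ s → z ∈ q
init-prefix [] (_ ∷ s) {x} {v} eq z∈ with () ← ++-conicalʳ s (x ∷ v) (sym (∷-injectiveʳ eq))
init-prefix (_ ∷ q) (_ ∷ s) eq (here refl) = here (sym (∷-injectiveˡ eq))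
init-prefix (_ ∷ q) (_ ∷ s) eq (there z∈) = there (init-prefix q s (∷-injectiveʳ eq) z∈)

last-∈ : ∀ (s : List A) {l} → l ∈ s ∷ʳ l
last-∈ s = ∈-++⁺ʳ s (here refl)

-- The hypothesis `0 < y` accounts for the default value 0, which `max 0 u` takes when `u` is empty.
max-dominated : ∀ {u v y} → y ∈ v → 0 ℕ.< y → All (ℕ._< y) u → max 0 u ℕ.< max 0 v
max-dominated {u} {v} y∈ 0<y u<y =
  max[xs]<max[ys]⁺ 0 v (inj₂ (lose y∈ 0<y)) (All.map (λ x<y → inj₂ (lose y∈ x<y)) u<y)

-- The inequality of maxima makes `v` nonempty. By induction its last letter is its largest, so it
-- exceeds `k` and, by the same inequality, all of `u`.
André-last : ∀ {w} → André w → ∀ s {l} → w ≡ s ∷ʳ l → All (ℕ._< l) s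
André-last empty [] ()
André-last empty (_ ∷ _) ()
André-last (single a) [] refl = []
André-last (single a) (_ ∷ s) eq with () ← ++-conicalʳ s _ (sym (∷-injectiveʳ eq))
André-last (split u k v refl k<u k<v _ Av m) s {l} eq with initLast v
... | [] = contradiction m λ ()
... | v′ ∷ʳ′ l′ with refl , refl ← ∷ʳ-injective (u ++ k ∷ v′) s
                       (trans (++-assoc u (k ∷ v′) [ l′ ]) eq) =
  Allₚ.++⁺ u<l (k<l ∷ v′<l)
  where
  v′<l = André-last Av v′ refl
  k<l = All.lookup k<v (last-∈ v′)
  u<l = All.map (λ x≤ → ℕₚ.≤-<-trans x≤ (ℕₚ.<-≤-trans m
          (max≤v⁺ z≤n (Allₚ.++⁺ (All.map ℕₚ.<⇒≤ v′<l) (ℕₚ.≤-refl ∷ []))))) (xs≤max 0 u)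

André-∷ : ∀ {b v} → André v → All (b ℕ.<_) v → André (b ∷ v)
André-∷ {b} {[]} _ _ = single b
André-∷ {b} {c ∷ v} Av b<v = split [] b (c ∷ v) refl [] b<v empty Av
  (max-dominated {[]} {c ∷ v} (here refl) (ℕₚ.≤-<-trans z≤n (All.head b<v)) [])

-- The letter y witnesses max u < max (b ∷ v).
André-++ : ∀ {u b v y} → André u → All (b ≢_) u → André v → All (b ℕ.<_) v →
           y ∈ b ∷ v → All (ℕ._< y) u → André (u ++ b ∷ v)
André-++ {u} {b} {v} {y} Au b≢u Av b<v y∈ u<y = go Au refl
  where
  -- Here `b` is the smallest letter of the concatenation, so the word splits at `b`. From
  -- `b < m < y` it follows that `y` is not `b` and hence lies in `v`.
  smaller : ∀ {m r} → m ∈ r → b ℕ.< m → All (b ℕ.<_) r → André r → All (ℕ._< y) r → André (r ++ b ∷ v)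
  smaller {m} {r} m∈ b<m b<r Ar r<y = split r b v refl b<r b<v Ar Av
    (max-dominated y∈v (ℕₚ.≤-<-trans z≤n m<y) r<y)
    where
    m<y = All.lookup r<y m∈
    inner : y ∈ b ∷ v → y ∈ v
    inner (here refl) = contradiction m<y (ℕₚ.<-asym b<m)
    inner (there p) = p
    y∈v = inner y∈

  go : ∀ {w} → André w → w ≡ u → André (u ++ b ∷ v)
  go empty refl = André-∷ Av b<v
  go (single x) refl with ℕₚ.<-cmp x b
  ... | tri< x<b _ _ = split [] x (b ∷ v) refl [] (x<b ∷ All.map (ℕₚ.<-trans x<b) b<v) empty
                         (André-∷ Av b<v)
                         (max-dominated {[]} {b ∷ v} (here refl) (ℕₚ.≤-<-trans z≤n x<b) [])
  ... | tri≈ _ refl _ = contradiction refl (All.head b≢u)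
  ... | tri> _ _ b<x = smaller (here refl) b<x (b<x ∷ []) (single x) u<y
  go (split l m r refl m<l m<r Al Ar l<r) refl with ℕₚ.<-cmp m b
  -- The smallest letter stays `m`, so only the right factor grows, and `y` dominates `l` as well.
  ... | tri< m<b _ _ = split l m (r ++ b ∷ v) (++-assoc l (m ∷ r) (b ∷ v)) m<l
                         (Allₚ.++⁺ m<r (m<b ∷ All.map (ℕₚ.<-trans m<b) b<v)) Al
                         (André-++ Ar (All.tail (Allₚ.++⁻ʳ l b≢u)) Av b<v y∈
                            (All.tail (Allₚ.++⁻ʳ l u<y)))
                         (max-dominated (∈-++⁺ʳ r y∈) (ℕₚ.≤-<-trans z≤n (All.head (Allₚ.++⁻ʳ l u<y)))
                            (Allₚ.++⁻ˡ l u<y))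
  ... | tri≈ _ refl _ = contradiction refl (All.head (Allₚ.++⁻ʳ l b≢u))
  ... | tri> _ _ b<m = smaller (∈-++⁺ʳ l (here refl)) b<m
                         (Allₚ.++⁺ (All.map (ℕₚ.<-trans b<m) m<l) (b<m ∷ All.map (ℕₚ.<-trans b<m) m<r))
                         (split l m r refl m<l m<r Al Ar l<r) u<y

-- Locate the smallest letter `m` relative to `i`. Before `i`: cut the right factor recursively.
-- Equal to `i`: a letter of `p` or `q` would be both above and below `i`, so both are empty. After
-- `i`: if a letter stood between them, the last one would exceed `i` by `André-last`, yet it
-- belongs to `q`; so `m` is `c` and the split is the cut.
André-cut : ∀ {w} p {i q b c t} → André w → w ≡ p ++ i ∷ c ∷ t → q ∷ʳ b ≡ c ∷ t →
            All (ℕ._< i) p → All (ℕ._< i) q → i ℕ.< b →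
            André (p ∷ʳ i) × All (c ℕ.<_) t × André t
André-cut p empty eq _ _ _ _ with () ← ++-conicalʳ p _ (sym eq)
André-cut [] (single a) () _ _ _ _
André-cut (_ ∷ p) (single a) eq _ _ _ _ with () ← ++-conicalʳ p _ (sym (∷-injectiveʳ eq))
André-cut p {i} {q} {b} {c} {t} (split l m r refl m<l m<r Al Ar l<r) eq eqᵗ p<i q<i i<b
  with ++-∷-compare l p eq
... | inj₁ (s , refl , refl) with As , c<t , At ← André-cut s Ar refl eqᵗ (All.tail (Allₚ.++⁻ʳ l p<i)) q<i i<b =
  split l m (s ∷ʳ i) (++-assoc l (m ∷ s) [ i ]) m<l
    (Allₚ.++⁺ (Allₚ.++⁻ˡ s m<r) (All.head (Allₚ.++⁻ʳ s m<r) ∷ [])) Al As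
    (max-dominated (last-∈ s) (ℕₚ.≤-<-trans z≤n (All.head (Allₚ.++⁻ʳ l p<i))) (Allₚ.++⁻ˡ l p<i))
  , c<t , At
... | inj₂ (inj₁ (refl , refl , refl)) = as p m<l p<i , at q eqᵗ q<i
  where
  as : ∀ p → All (i ℕ.<_) p → All (ℕ._< i) p → André (p ∷ʳ i)
  as [] _ _ = single i
  as (_ ∷ _) (i<x ∷ _) (x<i ∷ _) = contradiction x<i (ℕₚ.<-asym i<x)
  at : ∀ q → q ∷ʳ b ≡ c ∷ t → All (ℕ._< i) q → All (c ℕ.<_) t × André t
  at [] refl _ = [] , empty
  at (_ ∷ _) eq (x<i ∷ _) with refl , _ ← ∷-injective eq = contradiction x<i (ℕₚ.<-asym (All.head m<r))
... | inj₂ (inj₂ (s , refl , e)) with initLast s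
...   | [] with refl ← e = Al , m<r , Ar
...   | s′ ∷ʳ′ l′ = contradiction l′<i (ℕₚ.<-asym i<l′)
  where
  i<l′ : i ℕ.< l′
  i<l′ = All.lookup (André-last Al (p ++ i ∷ s′) (sym (++-assoc p (i ∷ s′) [ l′ ])))
           (∈-++⁺ʳ p (here refl))
  l′<i : l′ ℕ.< i
  l′<i = All.lookup q<i (init-prefix q (s′ ∷ʳ l′) (trans eqᵗ e) (last-∈ s′))

-- Orbits as paths.

-- The list contains the start but not the endpoint, so composing paths concatenates lists.
data Path (f : A → A) : A → List A → A → Set where
  []   : ∀ {x} → Path f x [] x
  step : ∀ {x s y} → Path f (f x) s y → Path f x (x ∷ s) y

module _ {f : A → A} where

  infixr 5 _++ᵖ_

  _++ᵖ_ : ∀ {x s y t z} → Path f x s y → Path f y t z → Path f x (s ++ t) z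
  [] ++ᵖ q = q
  step p ++ᵖ q = step (p ++ᵖ q)

  splitᵖ : ∀ {x} s {i t z} → Path f x (s ++ i ∷ t) z → Path f x s i × Path f i (i ∷ t) z
  splitᵖ [] p@(step _) = [] , p
  splitᵖ (_ ∷ s) (step p) with q , r ← splitᵖ s p = step q , r

  Path-[] : ∀ {x y} → Path f x [] y → x ≡ y
  Path-[] [] = refl

  Path-∷ʳ : ∀ {x s y z} → Path f x s y → f y ≡ z → Path f x (s ∷ʳ y) z
  Path-∷ʳ p refl = p ++ᵖ step []

  Path-∷ʳ⁻ : ∀ {x} s {y z} → Path f x (s ∷ʳ y) z → Path f x s y × f y ≡ z
  Path-∷ʳ⁻ s p with q , step [] ← splitᵖ s p = q , refl

  nonempty-Path : ∀ {x s y} → Path f x s y → ∃[ t ] s ∷ʳ y ≡ x ∷ t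
  nonempty-Path [] = [] , refl
  nonempty-Path (step {s = s} _) = s ∷ʳ _ , refl

  Path-successor : ∀ {x s y z} → Path f x s y → z ∈ s → f z ∈ s ⊎ f z ≡ y
  Path-successor (step []) (here refl) = inj₂ refl
  Path-successor (step (step p)) (here refl) = inj₁ (there (here refl))
  Path-successor (step p) (there z∈) with Path-successor p z∈
  ... | inj₁ fz∈ = inj₁ (there fz∈)
  ... | inj₂ eq = inj₂ eq

  Path-closed : ∀ {P : A → Set} → (∀ {z} → P z → P (f z)) →
                ∀ {x s y} → Path f x s y → P x → All P s × P y
  Path-closed cl [] px = [] , px
  Path-closed cl (step p) px with ps , py ← Path-closed cl p (cl px) = px ∷ ps , py

  -- Both paths follow one orbit and stop at its first visit to `y`.
  Path-deterministic : ∀ {x s t y} → Path f x s y → Path f x t y → y ∉ s → y ∉ t → s ≡ t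
  Path-deterministic [] [] _ _ = refl
  Path-deterministic [] (step _) _ y∉t = contradiction (here refl) y∉t
  Path-deterministic (step _) [] y∉s _ = contradiction (here refl) y∉s
  Path-deterministic (step p) (step q) y∉s y∉t =
    cong (_ ∷_) (Path-deterministic p q (y∉s ∘ there) (y∉t ∘ there))

  -- Prefixing the path to `y` with the loop gives another first arrival at `y`, and determinism
  -- would equate `t` with the longer `z ∷ s ++ t`.
  Path-acyclic : ∀ {x z s t y} → Path f x (z ∷ s) x → Path f x t y → y ∉ z ∷ s → y ∉ t → ⊥
  Path-acyclic {z = z} {s} {t} p q y∉s y∉t with () ← ++-identityˡ-unique (z ∷ s)
    (Path-deterministic q (p ++ᵖ q) y∉t ([ y∉s , y∉t ]′ ∘ ∈-++⁻ (z ∷ s)))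

Path-cong : ∀ {f g : A → A} {x s y} → (∀ {z} → z ∈ s → f z ≡ g z) → Path f x s y → Path g x s y
Path-cong eq [] = []
Path-cong {g = g} eq (step p) =
  step (subst (λ z → Path g z _ _) (eq (here refl)) (Path-cong (eq ∘ there) p))

-- Cycles as words from the smallest to the largest element.

letter : Fin n → ℕ
letter i = suc (toℕ i)

-- The cycle of f through k, given that k is its largest element and f k its
-- smallest one: f k ∷ tail is the cycle as a word, ending with k.
record Top (f : Fin n → Fin n) (k : Fin n) : Set where
  field
    init    : List (Fin n)
    tail    : List (Fin n)
    word≡   : init ∷ʳ k ≡ f k ∷ tail
    path    : Path f (f k) init k
    first<tail : All (f k Fin.<_) tail
    andré   : André (map letter tail)

  word : List (Fin n)
  word = init ∷ʳ k

open Top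

module _ {f : Fin n → Fin n} where

  last∈word : ∀ {k} (t : Top f k) → k ∈ word t
  last∈word t = last-∈ (init t)

  first∈word : ∀ {k} (t : Top f k) → f k ∈ word t
  first∈word t = subst (_ ∈_) (sym (word≡ t)) (here refl)

  word-path : ∀ {k} (t : Top f k) → Path f (f k) (word t) (f k)
  word-path t = Path-∷ʳ (path t) refl

  word-closed : ∀ {k} (t : Top f k) {x} → x ∈ word t → f x ∈ word t
  word-closed t x∈ with Path-successor (word-path t) x∈
  ... | inj₁ fx∈ = fx∈
  ... | inj₂ eq = subst (_∈ word t) (sym eq) (first∈word t)

  first≤word : ∀ {k} (t : Top f k) {x} → x ∈ word t → f k Fin.≤ x
  first≤word t x∈ with subst (_ ∈_) (word≡ t) x∈
  ... | here refl = ℕₚ.≤-refl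
  ... | there x∈tail = ℕₚ.<⇒≤ (All.lookup (first<tail t) x∈tail)

  -- The first letter is below the whole tail, which contains `k` when `init t` is nonempty; for the
  -- other letters `André-last` applies.
  init<last : ∀ {k} (t : Top f k) → All (Fin._< k) (init t)
  init<last {k} t = go (init t) (word≡ t)
    where
    go : ∀ s → s ∷ʳ k ≡ f k ∷ tail t → All (Fin._< k) s
    go [] _ = []
    go (x ∷ s) eq with x≡ , eqᵗ ← ∷-injective eq =
      subst (Fin._< k) (sym x≡) (All.lookup (first<tail t) (subst (k ∈_) eqᵗ (last-∈ s)))
      ∷ All.map ℕₚ.≤-pred (Allₚ.map⁻ (André-last (andré t) (map letter s)
          (trans (cong (map letter) (sym eqᵗ)) (map-++ letter s [ k ]))))

  last∉init : ∀ {k} (t : Top f k) → k ∉ init t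
  last∉init t k∈ = ℕₚ.<-irrefl refl (All.lookup (init<last t) k∈)

  word≤last : ∀ {k} (t : Top f k) {x} → x ∈ word t → x Fin.≤ k
  word≤last t x∈ with ∈-++⁻ (init t) x∈
  ... | inj₁ x∈init = ℕₚ.<⇒≤ (All.lookup (init<last t) x∈init)
  ... | inj₂ (here refl) = ℕₚ.≤-refl

  reaches-last : ∀ {k} (t : Top f k) {x} → x ∈ word t → ∃[ s ] Path f x s k
  reaches-last t x∈ with ∈-++⁻ (init t) x∈
  ... | inj₂ (here refl) = [] , []
  ... | inj₁ x∈init with s , r , eq ← ∈-∃++ x∈init =
    _ , proj₂ (splitᵖ s (subst (λ w → Path f _ w _) eq (path t)))

  -- The orbit of `x` reaches `k` without leaving `word t`, so `k ≤ l`; symmetrically `l ≤ k`. This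
  -- is the source of all disjointness of cycles below.
  Top-unique : ∀ {k l} (s : Top f k) (t : Top f l) {x} → x ∈ word s → x ∈ word t → k ≡ l
  Top-unique s t x∈s x∈t = Finₚ.≤-antisym (last≤ s t x∈s x∈t) (last≤ t s x∈t x∈s)
    where
    last≤ : ∀ {k l} (s : Top f k) (t : Top f l) {x} → x ∈ word s → x ∈ word t → k Fin.≤ l
    last≤ s t x∈s x∈t =
      word≤last t (proj₂ (Path-closed (word-closed t) (proj₂ (reaches-last s x∈s)) x∈t))

Top-cong : ∀ {f g : Fin n → Fin n} {k} (t : Top f k) → (∀ {x} → x ∈ word t → f x ≡ g x) →
           Σ (Top g k) λ t′ → word t′ ≡ word t
Top-cong {f = f} {g} {k} t eq = record
  { init    = init t
  ; tail    = tail t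
  ; word≡   = trans (word≡ t) (cong (_∷ tail t) fk)
  ; path    = subst (λ z → Path g z (init t) k) fk (Path-cong (eq ∘ ∈-++⁺ˡ) (path t))
  ; first<tail = subst (λ z → All (z Fin.<_) (tail t)) fk (first<tail t)
  ; andré   = andré t
  } , refl
  where fk = eq (last∈word t)

Top-init-unique : ∀ {f : Fin n → Fin n} {k} (s t : Top f k) → init s ≡ init t
Top-init-unique s t = Path-deterministic (path s) (path t) (last∉init s) (last∉init t)

-- Joining and cutting cycles by a transposition.

-- Composition with the transposition of `i` and `b`. The relation is symmetric in `f` and `g`, so
-- it describes both a switching and its undoing.
record Swapped (f g : Fin n → Fin n) (i b : Fin n) : Set where
  field
    at-left   : g i ≡ f b
    at-right  : g b ≡ f i
    elsewhere : ∀ {k} → k ≢ i → k ≢ b → f k ≡ g k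

open Swapped

Swapped-sym : ∀ {f g : Fin n → Fin n} {i b} → Swapped f g i b → Swapped g f i b
Swapped-sym sw = record
  { at-left   = sym (at-right sw)
  ; at-right  = sym (at-left sw)
  ; elsewhere = λ k≢i k≢b → sym (elsewhere sw k≢i k≢b)
  }

Top-other : ∀ {f g : Fin n → Fin n} {i b k} → Swapped f g i b → (t : Top f k) →
            i ∉ word t → b ∉ word t → Σ (Top g k) λ t′ → word t′ ≡ word t
Top-other sw t i∉ b∉ = Top-cong t λ x∈ → elsewhere sw (λ { refl → i∉ x∈ }) (λ { refl → b∉ x∈ })

-- Under `g` the orbit runs through `word s` to `i`, goes on to `g i ≡ f b`, runs through `word t`
-- to `b` and returns to `g b ≡ f i`. In `André-++` the witness is `b`, which exceeds all of
-- `word s` because `i < b`.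
Top-join : ∀ {f g : Fin n → Fin n} {i b} → Swapped f g i b → i Fin.< b → f i Fin.< f b →
           (s : Top f i) (t : Top f b) → Σ (Top g b) λ t′ → word t′ ≡ word s ++ word t
Top-join {f = f} {g} {i} {b} sw i<b fi<fb s t = record
  { init    = word s ++ init t
  ; tail    = tail s ++ f b ∷ tail t
  ; word≡   = trans eq (cong (_∷ tail s ++ f b ∷ tail t) (sym (at-right sw)))
  ; path    = subst (λ z → Path g z (word s ++ init t) b) (sym (at-right sw))
                (Path-∷ʳ (Path-cong init-s (path s)) (at-left sw) ++ᵖ Path-cong init-t (path t))
  ; first<tail = subst (λ z → All (z Fin.<_) (tail s ++ f b ∷ tail t)) (sym (at-right sw))
                (Allₚ.++⁺ (first<tail s) (fi<fb ∷ All.map (ℕₚ.<-trans fi<fb) (first<tail t)))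
  ; andré   = subst André (sym (map-++ letter (tail s) (f b ∷ tail t)))
                (André-++ (andré s) (Allₚ.map⁺ (All.tabulate fb∉)) (andré t)
                  (Allₚ.map⁺ (All.map s≤s (first<tail t)))
                  (∈-map⁺ letter (subst (b ∈_) (word≡ t) (last∈word t)))
                  (Allₚ.map⁺ (All.tabulate λ x∈ →
                    s≤s (ℕₚ.≤-<-trans (word≤last s (tail⊆ x∈)) i<b))))
  } , ++-assoc (word s) (init t) [ b ]
  where
  disjoint : ∀ {x} → x ∈ word s → x ∉ word t
  disjoint x∈s x∈t = ℕₚ.<-irrefl (cong toℕ (Top-unique s t x∈s x∈t)) i<b

  tail⊆ : ∀ {x} → x ∈ tail s → x ∈ word s
  tail⊆ x∈ = subst (_ ∈_) (sym (word≡ s)) (there x∈)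

  fb∉ : ∀ {x} → x ∈ tail s → letter (f b) ≢ letter x
  fb∉ x∈ e with refl ← Finₚ.toℕ-injective (ℕₚ.suc-injective e) = disjoint (tail⊆ x∈) (first∈word t)

  init-s : ∀ {x} → x ∈ init s → f x ≡ g x
  init-s x∈ = elsewhere sw (λ { refl → last∉init s x∈ })
                           (λ { refl → disjoint (∈-++⁺ˡ x∈) (last∈word t) })

  init-t : ∀ {x} → x ∈ init t → f x ≡ g x
  init-t x∈ = elsewhere sw (λ { refl → disjoint (last∈word s) (∈-++⁺ˡ x∈) })
                           (λ { refl → last∉init t x∈ })

  eq : (word s ++ init t) ∷ʳ b ≡ f i ∷ tail s ++ f b ∷ tail t
  eq = trans (++-assoc (word s) (init t) [ b ]) (cong₂ _++_ (word≡ s) (word≡ t))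

record Cut (g : Fin n → Fin n) (i b : Fin n) (w : List (Fin n)) : Set where
  field
    left       : Top g i
    right      : Top g b
    word-split : word left ++ word right ≡ w
    firsts     : g i Fin.< g b

-- `André-cut` concerns words stripped of their first letter `a`. The cut directly after `a`
-- remains: then `i` is the smallest letter, and `q`, whose letters are below `i`, is empty.
André-letters-cut : ∀ {a i b : Fin n} p q {u v c} → p ∷ʳ i ≡ a ∷ u → q ∷ʳ b ≡ c ∷ v →
                    All (a Fin.<_) (u ++ c ∷ v) → André (map letter (u ++ c ∷ v)) →
                    All (Fin._< i) p → All (Fin._< i) q → i Fin.< b →
                    André (map letter u) × All (c Fin.<_) v × André (map letter v)
André-letters-cut [] [] refl refl _ _ _ _ _ = empty , [] , empty
André-letters-cut [] (_ ∷ _) refl refl (i<c ∷ _) _ _ (c<i ∷ _) _ =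
  contradiction c<i (ℕₚ.<-asym i<c)
André-letters-cut {i = i} {b} (_ ∷ p) q {v = v} {c} refl eqv _ Auv (_ ∷ p<i) q<i i<b
  with Au , c<v , Av ← André-cut (map letter p) {letter i} {map letter q} {letter b} Auv
         (trans (map-++ letter (p ∷ʳ i) (c ∷ v))
           (trans (cong (_++ map letter (c ∷ v)) (map-++ letter p [ i ]))
                  (++-assoc (map letter p) [ letter i ] _)))
         (trans (sym (map-++ letter q [ b ])) (cong (map letter) eqv))
         (Allₚ.map⁺ (All.map s≤s p<i)) (Allₚ.map⁺ (All.map s≤s q<i)) (s≤s i<b) =
  subst André (sym (map-++ letter p [ i ])) Au , All.map ℕₚ.≤-pred (Allₚ.map⁻ c<v) , Av

-- Reverses `Top-join`. By the last hypothesis `i` is the second largest element of the cycle. Now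
-- `g` sends `i` back to the first letter `f b`, closing the left part, and `b` to `f i`, closing
-- the right part.
Top-cut : ∀ {f g : Fin n → Fin n} {i b} → Swapped f g i b → (t : Top f b) → i ∈ init t →
          (∀ {x} → x ∈ init t → x ≢ i → x Fin.< i) → Cut g i b (word t)
Top-cut {f = f} {g} {i} {b} sw t i∈ small
  with p , q , eq ← ∈-∃++ i∈
  with pathₚ , pathᵢ@(step pathq) ← splitᵖ p (subst (λ w → Path f _ w _) eq (path t))
  with u , wordₚ ← nonempty-Path pathₚ
  with v , wordq ← nonempty-Path pathq = record
  { left       = record
    { init    = p
    ; tail    = u
    ; word≡   = trans wordₚ (cong (_∷ u) (sym (at-left sw)))
    ; path    = subst (λ z → Path g z p i) (sym (at-left sw)) (Path-cong same-p pathₚ)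
    ; first<tail = subst (λ z → All (z Fin.<_) u) (sym (at-left sw)) (Allₚ.++⁻ˡ u first<)
    ; andré   = proj₁ cuts
    }
  ; right      = record
    { init    = q
    ; tail    = v
    ; word≡   = trans wordq (cong (_∷ v) (sym (at-right sw)))
    ; path    = subst (λ z → Path g z q b) (sym (at-right sw)) (Path-cong same-q pathq)
    ; first<tail = subst (λ z → All (z Fin.<_) v) (sym (at-right sw)) (proj₁ (proj₂ cuts))
    ; andré   = proj₂ (proj₂ cuts)
    }
  ; word-split = sym split-word
  ; firsts     = subst₂ Fin._<_ (sym (at-left sw)) (sym (at-right sw))
                   (All.head (Allₚ.++⁻ʳ u first<))
  }
  where
  p⊆ : ∀ {x} → x ∈ p → x ∈ init t
  p⊆ x∈ = subst (_ ∈_) (sym eq) (∈-++⁺ˡ x∈)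

  iq⊆ : ∀ {x} → x ∈ i ∷ q → x ∈ init t
  iq⊆ x∈ = subst (_ ∈_) (sym eq) (∈-++⁺ʳ p x∈)

  b∉ : b ∉ init t
  b∉ = last∉init t

  -- A return to `i` before `b` would be a loop avoiding `b`, although `b` is reached from `i`.
  -- Hence `i` occurs only once in the word.
  no-return : ∀ {z s} → Path f i (z ∷ s) i → (∀ {x} → x ∈ z ∷ s → x ∈ init t) → ⊥
  no-return r s⊆ = Path-acyclic r pathᵢ (b∉ ∘ s⊆) (b∉ ∘ iq⊆)

  i∉p : i ∉ p
  i∉p i∈p with p₁ , p₂ , refl ← ∈-∃++ i∈p =
    no-return (proj₂ (splitᵖ p₁ pathₚ)) (p⊆ ∘ ∈-++⁺ʳ p₁)

  i∉q : i ∉ q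
  i∉q i∈q with q₁ , q₂ , refl ← ∈-∃++ i∈q =
    no-return (proj₁ (splitᵖ (i ∷ q₁) pathᵢ)) λ { (here refl) → iq⊆ (here refl)
                                                ; (there x∈) → iq⊆ (there (∈-++⁺ˡ x∈)) }

  p<i : All (Fin._< i) p
  p<i = All.tabulate λ x∈ → small (p⊆ x∈) λ { refl → i∉p x∈ }

  q<i : All (Fin._< i) q
  q<i = All.tabulate λ x∈ → small (iq⊆ (there x∈)) λ { refl → i∉q x∈ }

  same-p : ∀ {x} → x ∈ p → f x ≡ g x
  same-p x∈ = elsewhere sw (λ { refl → i∉p x∈ }) (λ { refl → b∉ (p⊆ x∈) })

  same-q : ∀ {x} → x ∈ q → f x ≡ g x
  same-q x∈ = elsewhere sw (λ { refl → i∉q x∈ }) (λ { refl → b∉ (iq⊆ (there x∈)) })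

  split-word : word t ≡ (p ∷ʳ i) ++ (q ∷ʳ b)
  split-word = trans (cong (_∷ʳ b) eq)
    (trans (++-assoc p (i ∷ q) [ b ]) (sym (++-assoc p [ i ] (q ∷ʳ b))))

  tail≡ : tail t ≡ u ++ f i ∷ v
  tail≡ = ∷-injectiveʳ (trans (sym (word≡ t)) (trans split-word (cong₂ _++_ wordₚ wordq)))

  first< : All (f b Fin.<_) (u ++ f i ∷ v)
  first< = subst (All (f b Fin.<_)) tail≡ (first<tail t)

  cuts : André (map letter u) × All (f i Fin.<_) v × André (map letter v)
  cuts = André-letters-cut p q wordₚ wordq first< (subst (André ∘ map letter) tail≡ (andré t))
           p<i q<i (All.lookup (init<last t) i∈)

-- For a permutation this amounts to all cycles being André, stated through words ending with the
-- largest element.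
Covered : (Fin n → Fin n) → Set
Covered f = ∀ k → ∃[ b ] Σ (Top f b) λ t → k ∈ word t

module _ {f g : Fin n → Fin n} {i b} (sw : Swapped f g i b) (i<b : i Fin.< b) (fi<fb : f i Fin.< f b)
         (s : Top f i) (t : Top f b) where

  Top-apart : ∀ {k} → k ≢ i → k ≢ b → (r : Top f k) → Σ (Top g k) λ r′ → word r′ ≡ word r
  Top-apart k≢i k≢b r = Top-other sw r
    (λ i∈ → k≢i (Top-unique r s i∈ (last∈word s)))
    (λ b∈ → k≢b (Top-unique r t b∈ (last∈word t)))

  -- The joined cycle ends with `b` and the other cycles are untouched, so only `i` stops being a
  -- largest element.
  Top-after-join : ∀ {k} → k ≢ i → Top f k → Top g k
  Top-after-join {k} k≢i r with k Finₚ.≟ b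
  ... | yes refl = proj₁ (Top-join sw i<b fi<fb s t)
  ... | no k≢b = proj₁ (Top-apart k≢i k≢b r)

  Covered-join : Covered f → Covered g
  Covered-join cov x with cov x
  ... | k , r , x∈ with k Finₚ.≟ i | k Finₚ.≟ b
  ...   | yes refl | _ with t′ , eq ← Top-join sw i<b fi<fb r t =
    b , t′ , subst (x ∈_) (sym eq) (∈-++⁺ˡ x∈)
  ...   | no _ | yes refl with t′ , eq ← Top-join sw i<b fi<fb s r =
    b , t′ , subst (x ∈_) (sym eq) (∈-++⁺ʳ (word s) x∈)
  ...   | no k≢i | no k≢b with r′ , eq ← Top-apart k≢i k≢b r =
    k , r′ , subst (x ∈_) (sym eq) x∈

Top-fixed : ∀ {f : Fin n → Fin n} {k} → f k ≡ k → Σ (Top f k) λ t → k ∈ word t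
Top-fixed {f = f} {k} eq = record
  { init = [] ; tail = [] ; word≡ = cong [_] (sym eq)
  ; path = subst (λ z → Path f z [] k) (sym eq) [] ; first<tail = [] ; andré = empty } , here refl

-- Crossings under a transposition.

from-unique : ∀ (σ : Permutation′ n) {x y} → σ ⟨$⟩ʳ x ≡ y → σ ⟨$⟩ˡ y ≡ x
from-unique σ refl = inverseˡ σ

from-cong : ∀ (σ τ : Permutation′ n) → σ ≈ τ → ∀ y → σ ⟨$⟩ˡ y ≡ τ ⟨$⟩ˡ y
from-cong σ τ eq y = from-unique σ (trans (eq (τ ⟨$⟩ˡ y)) (inverseʳ τ))

Cr-cong : ∀ (σ τ : Permutation′ n) → σ ≈ τ → Cr σ ⊆ Cr τ
Cr-cong σ τ eq {x , y} (p , q) = subst (Fin._< y) (eq x) p , subst (x Fin.<_) (from-cong σ τ eq y) q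

module _ (σ τ : Permutation′ n) {i b} (sw : Swapped (σ ⟨$⟩ʳ_) (τ ⟨$⟩ʳ_) i b) where

  from-elsewhere : ∀ {y} → σ ⟨$⟩ˡ y ≢ i → σ ⟨$⟩ˡ y ≢ b → τ ⟨$⟩ˡ y ≡ σ ⟨$⟩ˡ y
  from-elsewhere ≢i ≢b = from-unique τ (trans (sym (elsewhere sw ≢i ≢b)) (inverseʳ σ))

  -- The value at `x` is unchanged, and the preimage of `y` changes at most between `i` and `b`,
  -- both to the right of `x`.
  Cr-left : i Fin.< b → ∀ {x y} → x Fin.< i → Cr σ (x , y) → Cr τ (x , y)
  Cr-left i<b {x} {y} x<i (σx<y , x<z) =
    subst (Fin._< y) (elsewhere sw (λ { refl → ℕₚ.<-irrefl refl x<i })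
                                   (λ { refl → ℕₚ.<-asym i<b x<i })) σx<y , x<from
    where
    x<from : x Fin.< τ ⟨$⟩ˡ y
    x<from with σ ⟨$⟩ˡ y Finₚ.≟ i | σ ⟨$⟩ˡ y Finₚ.≟ b
    ... | yes z≡i | _ = subst (x Fin.<_) (sym (from-unique τ
            (trans (at-right sw) (trans (cong (σ ⟨$⟩ʳ_) (sym z≡i)) (inverseʳ σ))))) (ℕₚ.<-trans x<i i<b)
    ... | no _ | yes z≡b = subst (x Fin.<_) (sym (from-unique τ
            (trans (at-left sw) (trans (cong (σ ⟨$⟩ʳ_) (sym z≡b)) (inverseʳ σ))))) x<i
    ... | no ≢i | no ≢b = subst (x Fin.<_) (sym (from-elsewhere ≢i ≢b)) x<z

  -- The preimage of `y` is not `i`, being to its right, and not `b`, since `σ b < y`; so it is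
  -- unchanged.
  Cr-column : ∀ {x y} → x ≡ i → τ ⟨$⟩ʳ i Fin.< y → σ ⟨$⟩ʳ b Fin.< y → Cr σ (x , y) → Cr τ (x , y)
  Cr-column {x} {y} refl τi<y σb<y (_ , i<z) =
    τi<y , subst (x Fin.<_) (sym (from-elsewhere (λ z≡i → ℕₚ.<-irrefl (cong toℕ (sym z≡i)) i<z) ≢b)) i<z
    where
    ≢b : σ ⟨$⟩ˡ y ≢ b
    ≢b z≡b = ℕₚ.<-irrefl (cong toℕ (trans (cong (σ ⟨$⟩ʳ_) (sym z≡b)) (inverseʳ σ))) σb<y

-- Resolutions keep all cycles André.

-- `remaining` supplies the two words that a switching joins. `E-upper` keeps the cells below a
-- remaining crossing outside `E`, so that crossings created by a switching can be traced back.
record Invariant (G : GridConfig n) : Set where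
  field
    E-upper   : ∀ {d e} → e ∈ᵖ E G → d ∈ᵖ Remaining G → ¬ d ⪰ e
    remaining : ∀ {x y} → (x , y) ∈ᵖ Remaining G →
                Top (perm G ⟨$⟩ʳ_) x × Top (perm G ⟨$⟩ʳ_) (perm G ⟨$⟩ˡ y)
    covered   : Covered (perm G ⟨$⟩ʳ_)

open Invariant

Invariant-initial : Invariant (initial {n})
Invariant-initial = record
  { E-upper   = λ ()
  ; remaining = λ _ → proj₁ (Top-fixed refl) , proj₁ (Top-fixed refl)
  ; covered   = λ k → k , Top-fixed refl
  }

Invariant-smooth : ∀ {G H : GridConfig n} {c} → MaximalRemaining G c → IsSmoothing G c H →
                   Invariant G → Invariant H
Invariant-smooth {G = G} {H} {c} (c∈ , c-max) sm I = record
  { E-upper   = λ e∈ d∈ d⪰e → upper (proj₁ E-extend e∈) d∈ d⪰e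
  ; remaining = λ {x} {y} d∈ → let t , t′ = remaining I (old d∈) in
      proj₁ (Top-same t) ,
      proj₁ (Top-same (subst (Top _) (sym (from-cong (perm H) (perm G) perm-same y)) t′))
  ; covered   = λ k → let b , t , k∈ = covered I k ; t′ , eq = Top-same t in
      b , t′ , subst (k ∈_) (sym eq) k∈
  }
  where
  open IsSmoothing sm
  Top-same : ∀ {k} (t : Top (perm G ⟨$⟩ʳ_) k) → Σ (Top (perm H ⟨$⟩ʳ_) k) λ t′ → word t′ ≡ word t
  Top-same t = Top-cong t λ {x} _ → sym (perm-same x)

  old : Remaining H ⊆ Remaining G
  old (d∈Cr , d∉E) = Cr-cong (perm H) (perm G) perm-same d∈Cr , λ d∈E → d∉E (proj₂ E-extend (inj₁ d∈E))

  upper : ∀ {d e} → e ∈ᵖ E G ⊎ c ≡ e → d ∈ᵖ Remaining H → ¬ d ⪰ e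
  upper (inj₁ e∈) d∈ d⪰e = E-upper I e∈ (old d∈) d⪰e
  -- By maximality such a crossing is `c` itself, which has just been smoothed.
  upper (inj₂ refl) d∈ d⪰c with refl ← c-max _ (old d∈) d⪰c = proj₂ d∈ (proj₂ E-extend (inj₂ refl))

IsSwitching⇒Swapped : ∀ {G H : GridConfig n} {i j} → IsSwitching G (i , j) H →
                      Swapped (perm G ⟨$⟩ʳ_) (perm H ⟨$⟩ʳ_) i (perm G ⟨$⟩ˡ j)
IsSwitching⇒Swapped {G = G} sw = record
  { at-left   = trans (IsSwitching.at-i sw) (sym (inverseʳ (perm G)))
  ; at-right  = IsSwitching.at-σ⁻¹j sw
  ; elsewhere = λ k≢i k≢b → sym (IsSwitching.elsewhere sw _ k≢i k≢b)
  }

module _ {G H : GridConfig n} {i j} (mx : MaximalRemaining G (i , j)) (sw : IsSwitching G (i , j) H)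
         (I : Invariant G) where

  private
    f g : Fin n → Fin n
    f = perm G ⟨$⟩ʳ_
    g = perm H ⟨$⟩ʳ_
    b : Fin n
    b = perm G ⟨$⟩ˡ j

    swapped : Swapped f g i b
    swapped = IsSwitching⇒Swapped {H = H} sw

    c∈ : (i , j) ∈ᵖ Remaining G
    c∈ = proj₁ mx
    fb : f b ≡ j
    fb = inverseʳ (perm G)
    i<b : i Fin.< b
    i<b = proj₂ (proj₁ c∈)
    fi<j : f i Fin.< j
    fi<j = proj₁ (proj₁ c∈)
    fi<fb : f i Fin.< f b
    fi<fb = subst (f i Fin.<_) (sym fb) fi<j
    topᵢ : Top f i
    topᵢ = proj₁ (remaining I c∈)
    top_b : Top f b
    top_b = proj₂ (remaining I c∈)

    old : ∀ {x z} → f x Fin.< f z → x Fin.< z → ¬ (x , f z) ∈ᵖ E G → (x , f z) ∈ᵖ Remaining G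
    old {x} fx<fz x<z ∉E = (fx<fz , subst (x Fin.<_) (sym (inverseˡ (perm G))) x<z) , ∉E

    old-tops : ∀ {x z} → (x , f z) ∈ᵖ Remaining G → Top f x × Top f z
    old-tops d∈ with t , t′ ← remaining I d∈ = t , subst (Top f) (inverseˡ (perm G)) t′

    below-∉E : ∀ {d} → (i , j) ⪰ d → ¬ d ∈ᵖ E G
    below-∉E c⪰d d∈E = E-upper I d∈E c∈ c⪰d

    -- A crossing (x , g z) that remains after the switching either remained before
    -- or is below (i , j).  In the second case another remaining crossing, in
    -- the same column or row, supplies the missing Top.
    record OldData (x z : Fin n) : Set where
      constructor oldData
      field
        x≢i    : x ≢ i
        z≢i    : z ≢ i
        top-x  : Top f x
        top-z  : Top f z
        origin : (x , g z) ∈ᵖ Remaining G ⊎ (i , j) ⪰ (x , g z)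

    -- The row is written `g z` so that the cases are the positions of `x` and `z` relative to `i`
    -- and `b`, away from which `f` and `g` agree.
    oldData-of : ∀ x z → g x Fin.< g z → x Fin.< z → ¬ (x , g z) ∈ᵖ E G → OldData x z
    oldData-of x z gx<gz x<z ∉E with x Finₚ.≟ i | x Finₚ.≟ b | z Finₚ.≟ i | z Finₚ.≟ b
    ... | yes refl | _ | yes refl | _ = contradiction x<z (ℕₚ.<-irrefl refl)
    ... | yes refl | _ | no _ | yes refl = contradiction fi<fb
          (ℕₚ.<-asym (subst₂ Fin._<_ (at-left swapped) (at-right swapped) gx<gz))
    -- The crossing would have remained higher up in column `i`, against maximality.
    ... | yes refl | _ | no z≢i | no z≢b = contradiction j<fz
          (ℕₚ.<-irrefl (cong toℕ (sym (cong proj₂ (proj₂ mx _ d∈ (ℕₚ.≤-refl , ℕₚ.<⇒≤ j<fz))))))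
      where
      gz = elsewhere swapped z≢i z≢b
      j<fz : j Fin.< f z
      j<fz = subst₂ Fin._<_ (trans (at-left swapped) fb) (sym gz) gx<gz
      d∈ : (i , f z) ∈ᵖ Remaining G
      d∈ = old (ℕₚ.<-trans fi<j j<fz) x<z (subst (λ y → ¬ (i , y) ∈ᵖ E G) (sym gz) ∉E)
    ... | no _ | yes refl | yes refl | _ = contradiction x<z (ℕₚ.<-asym i<b)
    ... | no _ | yes refl | no _ | yes refl = contradiction x<z (ℕₚ.<-irrefl refl)
    -- Above row `j` the crossing is old; otherwise `(i , f z)`, in the same row, remained below
    -- `(i , j)` and gives the top at `z`.
    ... | no x≢i | yes refl | no z≢i | no z≢b = moved (ℕₚ.<-≤-connex (toℕ j) (toℕ (f z)))
      where
      gz = elsewhere swapped z≢i z≢b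
      ∉E′ : ¬ (b , f z) ∈ᵖ E G
      ∉E′ = subst (λ y → ¬ (b , y) ∈ᵖ E G) (sym gz) ∉E
      moved : j Fin.< f z ⊎ f z Fin.≤ j → OldData b z
      moved (inj₁ j<fz) = oldData x≢i z≢i top_b (proj₂ (old-tops d∈))
                            (inj₁ (subst (λ y → (b , y) ∈ᵖ Remaining G) gz d∈))
        where d∈ = old (subst (Fin._< f z) (sym fb) j<fz) x<z ∉E′
      moved (inj₂ fz≤j) = oldData x≢i z≢i top_b (proj₂ (old-tops d∈))
                            (inj₂ (ℕₚ.<⇒≤ i<b , subst (Fin._≤ j) gz fz≤j))
        where
        d∈ = old {i} {z} (subst₂ Fin._<_ (at-right swapped) (sym gz) gx<gz) (ℕₚ.<-trans i<b x<z)
                 (below-∉E (ℕₚ.≤-refl , fz≤j))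
    -- The crossing would have remained further left in row `j`, against maximality.
    ... | no x≢i | no x≢b | yes refl | _ = contradiction (cong proj₁ (proj₂ mx _ d∈ (ℕₚ.<⇒≤ x<z , ℕₚ.≤-refl))) x≢i
      where
      gi = trans (at-left swapped) fb
      d∈ : (x , j) ∈ᵖ Remaining G
      d∈ = (subst₂ Fin._<_ (sym (elsewhere swapped x≢i x≢b)) gi gx<gz , ℕₚ.<-trans x<z i<b) ,
           subst (λ y → ¬ (x , y) ∈ᵖ E G) gi ∉E
    -- Left of column `i` the crossing is old, since its row is `g b ≡ f i`; otherwise `(x , j)`, in
    -- the same column, remained and gives the top at `x`.
    ... | no x≢i | no x≢b | no z≢i | yes refl = moved (ℕₚ.<-≤-connex (toℕ x) (toℕ i))
      where
      fx<fi : f x Fin.< f i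
      fx<fi = subst₂ Fin._<_ (sym (elsewhere swapped x≢i x≢b)) (at-right swapped) gx<gz
      moved : x Fin.< i ⊎ i Fin.≤ x → OldData x b
      moved (inj₁ x<i) = oldData x≢i z≢i (proj₁ (old-tops d∈)) top_b
                           (inj₁ (subst (λ y → (x , y) ∈ᵖ Remaining G) (sym (at-right swapped)) d∈))
        where
        d∈ = old {x} {i} fx<fi x<i (subst (λ y → ¬ (x , y) ∈ᵖ E G) (at-right swapped) ∉E)
      moved (inj₂ i≤x) = oldData x≢i z≢i (proj₁ (remaining I d∈)) top_b
                           (inj₂ (i≤x , ℕₚ.<⇒≤ (subst (Fin._< j) (sym (at-right swapped)) fi<j)))
        where
        d∈ : (x , j) ∈ᵖ Remaining G
        d∈ = (ℕₚ.<-trans fx<fi fi<j , x<z) , below-∉E (i≤x , ℕₚ.≤-refl)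
    ... | no x≢i | no x≢b | no z≢i | no z≢b =
      oldData x≢i z≢i (proj₁ (old-tops d∈)) (proj₂ (old-tops d∈))
        (inj₁ (subst (λ y → (x , y) ∈ᵖ Remaining G) gz d∈))
      where
      gz = elsewhere swapped z≢i z≢b
      d∈ = old (subst₂ Fin._<_ (sym (elsewhere swapped x≢i x≢b)) (sym gz) gx<gz) x<z
               (subst (λ y → ¬ (x , y) ∈ᵖ E G) (sym gz) ∉E)

    oldData-Remaining : ∀ {x y} → (x , y) ∈ᵖ Remaining H → OldData x (perm H ⟨$⟩ˡ y)
    oldData-Remaining {x} {y} ((gx<y , x<z) , ∉E) = oldData-of x _
      (subst (g x Fin.<_) (sym gz) gx<y) x<z
      (λ ∈E → ∉E (subst (λ y → (x , y) ∈ᵖ E H) gz (proj₂ (IsSwitching.E-same sw) ∈E)))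
      where gz = inverseʳ (perm H)

  Invariant-switch : Invariant H
  Invariant-switch = record
    { E-upper   = λ e∈ d∈ d⪰e → upper (proj₁ (IsSwitching.E-same sw) e∈) d∈ d⪰e
    ; remaining = λ d∈ → let open OldData (oldData-Remaining d∈) in after x≢i top-x , after z≢i top-z
    ; covered   = Covered-join swapped i<b fi<fb topᵢ top_b (covered I)
    }
    where
    after : ∀ {k} → k ≢ i → Top f k → Top g k
    after = Top-after-join swapped i<b fi<fb topᵢ top_b

    upper : ∀ {d e} → e ∈ᵖ E G → d ∈ᵖ Remaining H → ¬ d ⪰ e
    upper {x , y} e∈ d∈ (p , q)
      with subst (λ y → (x , y) ∈ᵖ Remaining G ⊎ (i , j) ⪰ (x , y)) (inverseʳ (perm H))
             (OldData.origin (oldData-Remaining d∈))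
    ... | inj₁ d∈G = E-upper I e∈ d∈G (p , q)
    -- By transitivity the smoothed cell would lie below `(i , j)`, which remained in `G`.
    ... | inj₂ (p′ , q′) = below-∉E (ℕₚ.≤-trans p′ p , ℕₚ.≤-trans q q′) e∈

Invariant-reachable : ∀ {G H : GridConfig n} → Star _⟶_ G H → Invariant G → Invariant H
Invariant-reachable ε I = I
Invariant-reachable (smooth c mx sm ◅ r) I = Invariant-reachable r (Invariant-smooth mx sm I)
Invariant-reachable (switch c mx sw ◅ r) I = Invariant-reachable r (Invariant-switch mx sw I)

-- From words to cycle notation.

maps⇒Path : ∀ {f : A → A} x s {y} → map f (x ∷ s) ≡ s ∷ʳ y → Path f x (x ∷ s) y
maps⇒Path x [] eq with refl ← ∷-injectiveˡ eq = step []
maps⇒Path x (z ∷ s) eq with refl ← ∷-injectiveˡ eq = step (maps⇒Path z s (∷-injectiveʳ eq))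

Path⇒maps : ∀ {f : A → A} {x s y} → Path f x (x ∷ s) y → map f (x ∷ s) ≡ s ∷ʳ y
Path⇒maps (step []) = refl
Path⇒maps (step (step p)) = cong (_ ∷_) (Path⇒maps (step p))

cycle-closed : ∀ {f : A → A} {x s} → Path f x (x ∷ s) x → ∀ {z} → z ∈ x ∷ s → f z ∈ x ∷ s
cycle-closed p z∈ with Path-successor p z∈
... | inj₁ fz∈ = fz∈
... | inj₂ eq = here eq

-- The given cycle and the covering word share an element, and both start at their minimum, so their
-- first letters agree; the rest is determined up to the first return.
Covered⇒André : ∀ (σ : Permutation′ n) → Covered (σ ⟨$⟩ʳ_) → (C : Cycle σ) → IsAndréCycle C
Covered⇒André σ cov C with b , t , first∈ ← cov (Cycle.first C) =
  subst (André ∘ map letter) same-rest (andré t)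
  where
  open Cycle C
  f = σ ⟨$⟩ʳ_
  cyc : Path f first (first ∷ rest) first
  cyc = maps⇒Path first rest maps

  fb∈ : f b ∈ first ∷ rest
  fb∈ = proj₂ (Path-closed (cycle-closed cyc) (Path-∷ʳ (proj₂ (reaches-last t first∈)) refl) (here refl))

  first≤ : first Fin.≤ f b
  first≤ with fb∈
  ... | here eq = ℕₚ.≤-reflexive (cong toℕ (sym eq))
  ... | there ∈rest = All.lookup minimal ∈rest

  fb≡first : f b ≡ first
  fb≡first = Finₚ.≤-antisym (first≤word t first∈) first≤

  word-cyc : Path f first (first ∷ tail t) first
  word-cyc = subst (λ z → Path f z (z ∷ tail t) z) fb≡first
               (subst (λ w → Path f (f b) w (f b)) (word≡ t) (word-path t))

  same-rest : tail t ≡ rest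
  same-rest with step p ← word-cyc | step q ← cyc = Path-deterministic p q
    (λ first∈tail → ℕₚ.<-irrefl (cong toℕ fb≡first) (All.lookup (first<tail t) first∈tail))
    (λ first∈rest → All.lookup (AllPairs.head distinct) first∈rest refl)

-- Building a permutation column by column.

-- `Q` is the processed region: the smoothed cells are exactly the crossings of `σ` inside it.
Reach : Permutation′ n → Pred (Cell n) 0ℓ → Set₁
Reach {n} σ Q = ∃[ G ] Star _⟶_ (initial {n}) G × perm G ≈ σ × E G ≐ (Cr σ ∩ Q)

Reach-resp : ∀ (σ : Permutation′ n) {P Q} → (∀ {d} → d ∈ᵖ Cr σ → P d → Q d) → (∀ {d} → d ∈ᵖ Cr σ → Q d → P d) →
             Reach σ P → Reach σ Q
Reach-resp _ P⇒Q Q⇒P (G , r , G≈ , E⊆ , ⊆E) =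
  G , r , G≈ , (λ e∈ → let c , p = E⊆ e∈ in c , P⇒Q c p) , (λ (c , q) → ⊆E (c , Q⇒P c q))

module _ (G : GridConfig n) (σ : Permutation′ n) {Q : Pred (Cell n) 0ℓ}
         (G≈ : perm G ≈ σ) (E≐ : E G ≐ (Cr σ ∩ Q)) where

  Remaining⇒∉ : ∀ {d} → d ∈ᵖ Remaining G → d ∈ᵖ Cr σ × ¬ Q d
  Remaining⇒∉ {d} (c , ∉E) with c′ ← Cr-cong (perm G) σ G≈ {d} c = c′ , λ q → ∉E (proj₂ E≐ (c′ , q))

  maximal : ∀ {c} → c ∈ᵖ Cr σ → ¬ Q c → (∀ {d} → d ∈ᵖ Cr σ → ¬ Q d → d ⪰ c → d ≡ c) → MaximalRemaining G c
  maximal {c} c∈ c∉Q mx =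
    (Cr-cong σ (perm G) (sym ∘ G≈) {c} c∈ , λ c∈E → c∉Q (proj₂ (proj₁ E≐ c∈E))) ,
    λ d d∈ d⪰c → let d∈Cr , d∉Q = Remaining⇒∉ d∈ in mx d∈Cr d∉Q d⪰c

Reach-smooth : ∀ (σ : Permutation′ n) {Q c} → c ∈ᵖ Cr σ → ¬ Q c →
               (∀ {d} → d ∈ᵖ Cr σ → ¬ Q d → d ⪰ c → d ≡ c) →
               Reach σ Q → Reach σ (Q ∪ ｛ c ｝)
Reach-smooth σ {Q} {c} c∈ c∉Q mx (G , r , G≈ , E≐) =
  H , r ◅◅ smooth c (maximal G σ G≈ E≐ c∈ c∉Q mx) smoothing ◅ ε , (λ _ → refl) , (λ e → e) , (λ e → e)
  where
  H : GridConfig _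
  H = record { perm = σ ; E = Cr σ ∩ (Q ∪ ｛ c ｝) ; E⊆Cr = proj₁ }
  smoothing : IsSmoothing G c H
  smoothing = record
    { perm-same = sym ∘ G≈
    ; E-extend  = (λ { (d∈ , inj₁ q) → inj₁ (proj₂ E≐ (d∈ , q)) ; (_ , inj₂ eq) → inj₂ eq })
                , (λ { (inj₁ e) → let d∈ , q = proj₁ E≐ e in d∈ , inj₁ q ; (inj₂ refl) → c∈ , inj₂ refl })
    }

-- Columns and rows are counted from 0.
Before : ℕ → Pred (Cell n) 0ℓ
Before m (x , _) = toℕ x ℕ.< m

Above : Fin n → ℕ → Pred (Cell n) 0ℓ
Above i m (x , y) = x Fin.< i ⊎ (x ≡ i × m ≤ toℕ y)

-- A cell dominating `(i , j)` lies in an earlier column or higher in column `i`, hence is already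
-- processed, unless it is `(i , j)`. This is why columns are processed downwards.
Above-maximal : ∀ {i j : Fin n} {d} → ¬ Above i (suc (toℕ j)) d → d ⪰ (i , j) → d ≡ (i , j)
Above-maximal {d = x , y} ∉ (x≤i , j≤y) with ℕₚ.m≤n⇒m<n∨m≡n x≤i
... | inj₁ x<i = contradiction (inj₁ x<i) ∉
... | inj₂ eq with refl ← Finₚ.toℕ-injective eq =
  cong (x ,_) (Finₚ.≤-antisym (ℕₚ.≮⇒≥ (λ j<y → ∉ (inj₂ (refl , j<y)))) j≤y)

∉Above : ∀ {i j : Fin n} → ¬ Above i (suc (toℕ j)) (i , j)
∉Above (inj₁ i<i) = ℕₚ.<-irrefl refl i<i
∉Above (inj₂ (_ , j<j)) = ℕₚ.<-irrefl refl j<j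

module _ (σ : Permutation′ n) (i : Fin n) (start : Reach σ (Before (toℕ i))) where

  Reach-cell : ∀ j → Reach σ (Above i (suc (toℕ j))) → Reach σ (Above i (toℕ j))
  Reach-cell j r with (σ ⟨$⟩ʳ i Finₚ.<? j) ×-dec (i Finₚ.<? σ ⟨$⟩ˡ j)
  ... | yes c∈ = Reach-resp σ (λ _ → to) (λ _ → from) (Reach-smooth σ c∈ ∉Above (λ _ → Above-maximal) r)
    where
    to : ∀ {d} → (Above i (suc (toℕ j)) ∪ ｛ i , j ｝) d → Above i (toℕ j) d
    to (inj₁ (inj₁ x<i)) = inj₁ x<i
    to (inj₁ (inj₂ (x≡i , j<y))) = inj₂ (x≡i , ℕₚ.<⇒≤ j<y)
    to (inj₂ refl) = inj₂ (refl , ℕₚ.≤-refl)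
    from : ∀ {d} → Above i (toℕ j) d → (Above i (suc (toℕ j)) ∪ ｛ i , j ｝) d
    from (inj₁ x<i) = inj₁ (inj₁ x<i)
    from (inj₂ (refl , j≤y)) with ℕₚ.m≤n⇒m<n∨m≡n j≤y
    ... | inj₁ j<y = inj₁ (inj₂ (refl , j<y))
    ... | inj₂ eq = inj₂ (cong (i ,_) (Finₚ.toℕ-injective eq))
  ... | no c∉ = Reach-resp σ to from r
    where
    to : ∀ {d} → d ∈ᵖ Cr σ → Above i (suc (toℕ j)) d → Above i (toℕ j) d
    to _ (inj₁ x<i) = inj₁ x<i
    to _ (inj₂ (x≡i , j<y)) = inj₂ (x≡i , ℕₚ.<⇒≤ j<y)
    from : ∀ {d} → d ∈ᵖ Cr σ → Above i (toℕ j) d → Above i (suc (toℕ j)) d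
    from _ (inj₁ x<i) = inj₁ x<i
    from d∈ (inj₂ (refl , j≤y)) with ℕₚ.m≤n⇒m<n∨m≡n j≤y
    ... | inj₁ j<y = inj₂ (refl , j<y)
    ... | inj₂ eq with refl ← Finₚ.toℕ-injective eq = contradiction d∈ c∉

  -- Here `k` counts the rows from `m` upwards. For `k = 0` there are none, and the region is that
  -- of `start`.
  Reach-column : ∀ k m → m ℕ.+ k ≡ n → Reach σ (Above i m)
  Reach-column zero m eq = Reach-resp σ (λ _ → inj₁)
    (λ { _ (inj₁ x<i) → x<i
       ; {_ , y} _ (inj₂ (_ , m≤y)) → contradiction (Finₚ.toℕ<n y)
           (ℕₚ.≤⇒≯ (subst (_≤ toℕ y) (trans (sym (ℕₚ.+-identityʳ m)) eq) m≤y)) })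
    start
  Reach-column (suc k) m eq = subst (Reach σ ∘ Above i) toℕ≡
    (Reach-cell j (subst (Reach σ ∘ Above i ∘ suc) (sym toℕ≡)
      (Reach-column k (suc m) (trans (sym (ℕₚ.+-suc m k)) eq))))
    where
    m<n : m ℕ.< n
    m<n = subst (m ℕ.<_) eq (ℕₚ.m<m+n m (s≤s z≤n))
    j = Fin.fromℕ< m<n
    toℕ≡ = Finₚ.toℕ-fromℕ< m<n

  Reach-Above : ∀ {m} → m ≤ n → Reach σ (Above i m)
  Reach-Above {m} m≤n = Reach-column (n ℕ.∸ m) m (ℕₚ.m+[n∸m]≡n m≤n)

  Reach-smooth-column : Reach σ (Before (suc (toℕ i)))
  Reach-smooth-column = Reach-resp σ
    (λ { _ (inj₁ x<i) → ℕₚ.m<n⇒m<1+n x<i ; _ (inj₂ (refl , _)) → ℕₚ.≤-refl })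
    (λ { _ (s≤s x≤i) → weaken (ℕₚ.m≤n⇒m<n∨m≡n x≤i) })
    (Reach-Above z≤n)
    where
    weaken : ∀ {x y} → x Fin.< i ⊎ toℕ x ≡ toℕ i → Above i 0 (x , y)
    weaken (inj₁ x<i) = inj₁ x<i
    weaken (inj₂ eq) = inj₂ (Finₚ.toℕ-injective eq , z≤n)

-- Column `i` is smoothed above row `j`, then `(i , j)` is switched. Since `τ i ≡ j`, the crossings
-- of `τ` in column `i` all lie above row `j` and are the ones already smoothed, so the column is
-- finished.
Reach-switch : ∀ (σ τ : Permutation′ n) {i b} → Swapped (σ ⟨$⟩ʳ_) (τ ⟨$⟩ʳ_) i b →
               i Fin.< b → σ ⟨$⟩ʳ i Fin.< σ ⟨$⟩ʳ b →
               Reach σ (Before (toℕ i)) → Reach τ (Before (suc (toℕ i)))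
Reach-switch {n} σ τ {i} {b} sw i<b σi<σb start
  with G , r , G≈ , E≐ ← Reach-Above σ i start {suc (toℕ (σ ⟨$⟩ʳ b))} (Finₚ.toℕ<n (σ ⟨$⟩ʳ b)) =
  H , r ◅◅ switch (i , j) (maximal G σ G≈ E≐ c∈ ∉Above (λ _ → Above-maximal)) (switching G G≈ E≐) ◅ ε ,
  (λ _ → refl) , (λ e → e) , (λ e → e)
  where
  j : Fin n
  j = σ ⟨$⟩ʳ b
  H : GridConfig n
  H = record { perm = τ ; E = Cr τ ∩ Before (suc (toℕ i)) ; E⊆Cr = proj₁ }
  c∈ : (i , j) ∈ᵖ Cr σ
  c∈ = σi<σb , subst (i Fin.<_) (sym (inverseˡ σ)) i<b

  τ⇒σ : ∀ {d} → d ∈ᵖ (Cr τ ∩ Before (suc (toℕ i))) → d ∈ᵖ (Cr σ ∩ Above i (suc (toℕ j)))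
  τ⇒σ {x , y} (d∈ , s≤s x≤i) with ℕₚ.m≤n⇒m<n∨m≡n x≤i
  ... | inj₁ x<i = Cr-left τ σ (Swapped-sym sw) i<b x<i d∈ , inj₁ x<i
  ... | inj₂ eq with refl ← Finₚ.toℕ-injective eq =
    Cr-column τ σ (Swapped-sym sw) refl σi<y (subst (Fin._< y) (sym (at-right sw)) σi<y) d∈ , inj₂ (refl , j<y)
    where
    j<y : j Fin.< y
    j<y = subst (Fin._< y) (at-left sw) (proj₁ d∈)
    σi<y : σ ⟨$⟩ʳ i Fin.< y
    σi<y = ℕₚ.<-trans σi<σb j<y

  σ⇒τ : ∀ {d} → d ∈ᵖ (Cr σ ∩ Above i (suc (toℕ j))) → d ∈ᵖ (Cr τ ∩ Before (suc (toℕ i)))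
  σ⇒τ (d∈ , inj₁ x<i) = Cr-left σ τ sw i<b x<i d∈ , ℕₚ.m<n⇒m<1+n x<i
  σ⇒τ {_ , y} (d∈ , inj₂ (refl , j<y)) =
    Cr-column σ τ sw refl (subst (Fin._< y) (sym (at-left sw)) j<y) j<y d∈ , ℕₚ.≤-refl

  module _ (G : GridConfig n) (G≈ : perm G ≈ σ) (E≐ : E G ≐ (Cr σ ∩ Above i (suc (toℕ j)))) where
    from≡ : perm G ⟨$⟩ˡ j ≡ b
    from≡ = trans (from-cong (perm G) σ G≈ j) (inverseˡ σ)

    switching : IsSwitching G (i , j) H
    switching = record
      { at-i      = at-left sw
      ; at-σ⁻¹j   = trans (cong (τ ⟨$⟩ʳ_) from≡) (trans (at-right sw) (sym (G≈ i)))
      ; elsewhere = λ k k≢i k≢ → trans (sym (elsewhere sw k≢i (λ k≡b → k≢ (trans k≡b (sym from≡))))) (sym (G≈ k))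
      ; E-same    = (λ e → proj₂ E≐ (τ⇒σ e)) , (λ e → σ⇒τ (proj₁ E≐ e))
      }

-- Up to the choice of E, these are the permutations that occur when exactly the
-- first m columns have been processed.
Stage : ℕ → (Fin n → Fin n) → Set
Stage m f = Covered f × (∀ k → m ≤ toℕ k → Top f k)

-- Any element of `init t` would also be the largest of its cycle, hence equal to `k`; so `init t`
-- is empty.
Stage-0 : ∀ {f : Fin n → Fin n} → Stage 0 f → ∀ k → k ≡ f k
Stage-0 {f = f} (_ , tops) k = go (init t) refl (path t)
  where
  t = tops k z≤n
  go : ∀ s → s ≡ init t → Path f (f k) s k → k ≡ f k
  go [] _ p = sym (Path-[] p)
  go (x ∷ _) eq _ with x∈ ← subst (x ∈_) eq (here refl)
    with refl ← Top-unique (tops x z≤n) t (last∈word (tops x z≤n)) (∈-++⁺ˡ x∈) =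
    contradiction x∈ (last∉init t)

-- Elements above `i` are largest in their cycles, so below `b` nothing in the cycle exceeds `i`,
-- and `Top-cut` applies.
Stage-cut : ∀ {f g : Fin n → Fin n} {i b} → Swapped f g i b → i Fin.< b → Stage (suc (toℕ i)) f →
            (t : Top f b) → i ∈ init t → Stage (toℕ i) g × g i Fin.< g b
Stage-cut {f = f} {g} {i} {b} sw i<b (cov , tops) t i∈ = (cov′ , tops′) , firsts
  where
  small : ∀ {x} → x ∈ init t → x ≢ i → x Fin.< i
  small {x} x∈ x≢i with ℕₚ.<-cmp (toℕ x) (toℕ i)
  ... | tri< x<i _ _ = x<i
  ... | tri≈ _ eq _ = contradiction (Finₚ.toℕ-injective eq) x≢i
  ... | tri> _ _ i<x with refl ← Top-unique (tops x i<x) t (last∈word (tops x i<x)) (∈-++⁺ˡ x∈) =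
    contradiction x∈ (last∉init t)

  open Cut (Top-cut sw t i∈ small)

  apart : ∀ {k} → k ≢ b → (r : Top f k) → Σ (Top g k) λ r′ → word r′ ≡ word r
  apart k≢b r = Top-other sw r (λ i∈r → k≢b (Top-unique r t i∈r (∈-++⁺ˡ i∈)))
                               (λ b∈r → k≢b (Top-unique r t b∈r (last∈word t)))

  cov′ : Covered g
  cov′ x with cov x
  ... | k , r , x∈ with k Finₚ.≟ b
  ...   | no k≢b with r′ , eq ← apart k≢b r = k , r′ , subst (x ∈_) (sym eq) x∈
  ...   | yes refl = [ (λ x∈l → i , left , x∈l) , (λ x∈r → b , right , x∈r) ]′
    (∈-++⁻ (word left) (subst (x ∈_) (trans (cong (_∷ʳ b) (Top-init-unique r t)) (sym word-split)) x∈))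

  tops′ : ∀ k → i Fin.≤ k → Top g k
  tops′ k i≤k with ℕₚ.m≤n⇒m<n∨m≡n i≤k | k Finₚ.≟ b
  ... | inj₂ eq | _ = subst (Top g) (Finₚ.toℕ-injective eq) left
  ... | inj₁ _ | yes refl = right
  ... | inj₁ i<k | no k≢b = proj₁ (apart k≢b (tops k i<k))

transpose-left : ∀ (i b : Fin n) → transpose i b ⟨$⟩ʳ i ≡ b
transpose-left i b rewrite dec-true (i Finₚ.≟ i) refl = refl

transpose-right : ∀ (i b : Fin n) → transpose i b ⟨$⟩ʳ b ≡ i
transpose-right i b with b Finₚ.≟ i
... | yes b≡i = b≡i
... | no _ rewrite dec-true (b Finₚ.≟ b) refl = refl

transpose-elsewhere : ∀ (i b : Fin n) {k} → k ≢ i → k ≢ b → transpose i b ⟨$⟩ʳ k ≡ k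
transpose-elsewhere i b {k} k≢i k≢b
  rewrite dec-false (k Finₚ.≟ i) k≢i | dec-false (k Finₚ.≟ b) k≢b = refl

Swapped-transpose : ∀ (σ : Permutation′ n) i b → Swapped (σ ⟨$⟩ʳ_) ((transpose i b ∘ₚ σ) ⟨$⟩ʳ_) i b
Swapped-transpose σ i b = record
  { at-left   = cong (σ ⟨$⟩ʳ_) (transpose-left i b)
  ; at-right  = cong (σ ⟨$⟩ʳ_) (transpose-right i b)
  ; elsewhere = λ k≢i k≢b → cong (σ ⟨$⟩ʳ_) (sym (transpose-elsewhere i b k≢i k≢b))
  }

Reach-next : ∀ (i : Fin n) → (∀ τ → Stage (toℕ i) (τ ⟨$⟩ʳ_) → Reach τ (Before (toℕ i))) →
             ∀ σ → Stage (suc (toℕ i)) (σ ⟨$⟩ʳ_) → Reach σ (Before (suc (toℕ i)))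
Reach-next i IH σ st@(cov , tops) with b , t , i∈ ← cov i with ∈-++⁻ (init t) i∈
... | inj₂ (here refl) = Reach-smooth-column σ i (IH σ (cov , tops′))
  where
  tops′ : ∀ k → i Fin.≤ k → Top (σ ⟨$⟩ʳ_) k
  tops′ k i≤k with ℕₚ.m≤n⇒m<n∨m≡n i≤k
  ... | inj₁ i<k = tops k i<k
  ... | inj₂ eq = subst (Top _) (Finₚ.toℕ-injective eq) t
... | inj₁ i∈init = Reach-switch τ σ (Swapped-sym sw) i<b (proj₂ cut) (IH τ (proj₁ cut))
  where
  -- `∘ₚ` applies its left argument first, so the values at `i` and `b` are exchanged.
  τ = transpose i b ∘ₚ σ
  sw = Swapped-transpose σ i b
  i<b = All.lookup (init<last t) i∈init
  cut = Stage-cut sw i<b st t i∈init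

Reach-stage : ∀ m → m ≤ n → ∀ (σ : Permutation′ n) → Stage m (σ ⟨$⟩ʳ_) → Reach σ (Before m)
Reach-stage zero _ σ st = initial , ε , Stage-0 st , (λ ()) , (λ ())
-- The induction step speaks of a column in `Fin n`; the transport replaces its index by `m`.
Reach-stage {n} (suc m) m<n = subst
  (λ m → (∀ (τ : Permutation′ n) → Stage m (τ ⟨$⟩ʳ_) → Reach τ (Before m)) →
         ∀ σ → Stage (suc m) (σ ⟨$⟩ʳ_) → Reach σ (Before (suc m)))
  (Finₚ.toℕ-fromℕ< m<n) (Reach-next (Fin.fromℕ< m<n)) (Reach-stage m (ℕₚ.<⇒≤ m<n))

Covered⇒IsWeb : ∀ (σ : Permutation′ n) → Covered (σ ⟨$⟩ʳ_) → IsWeb σ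
Covered⇒IsWeb {n} σ cov
  with G , r , G≈ , E⊆ , ⊆E ← Reach-stage n ℕₚ.≤-refl σ (cov , λ k n≤k → contradiction (Finₚ.toℕ<n k) (ℕₚ.≤⇒≯ n≤k)) =
  G , r , G≈ , E⊆Cr G , λ {d} c → ⊆E (Cr-cong (perm G) σ G≈ {d} c , Finₚ.toℕ<n (proj₁ d))

-- Every element lies on a cycle.

iterate : (A → A) → A → ℕ → A
iterate f x zero = x
iterate f x (suc k) = f (iterate f x k)

iterate-Path : ∀ (f : A → A) x k → ∃[ s ] Path f x s (iterate f x k)
iterate-Path f x zero = [] , []
iterate-Path f x (suc k) with s , p ← iterate-Path f x k = _ , Path-∷ʳ p refl

iterate-cancel : ∀ {f : A → A} → (∀ {y z} → f y ≡ f z → y ≡ z) →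
                 ∀ {x} p q → p ℕ.< q → iterate f x p ≡ iterate f x q → ∃[ k ] iterate f x (suc k) ≡ x
iterate-cancel inj zero (suc q) _ eq = q , sym eq
iterate-cancel inj (suc p) (suc q) (s≤s p<q) eq = iterate-cancel inj p q p<q (inj eq)

first-arrival : ∀ {f : Fin n → Fin n} {x s y} → Path f x s y → ∃[ t ] Path f x t y × y ∉ t
first-arrival [] = [] , [] , λ ()
first-arrival {x = x} {y = y} (step p) with y Finₚ.≟ x
... | yes refl = [] , [] , λ ()
... | no y≢x with t , q , y∉t ← first-arrival p =
  x ∷ t , step q , λ { (here y≡x) → y≢x y≡x ; (there y∈t) → y∉t y∈t }

Path-Unique : ∀ {f : A → A} {x s y} → Path f x s y → y ∉ s → Unique s
Path-Unique [] _ = []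
Path-Unique {x = x} q@(step {s = s} p) y∉ = Allₚ.¬Any⇒All¬ s x∉s ∷ Path-Unique p (y∉ ∘ there)
  where
  x∉s : x ∉ s
  x∉s x∈ with u , v , refl ← ∈-∃++ x∈ =
    Path-acyclic (proj₁ (splitᵖ (x ∷ u) q)) q
      (λ { (here eq) → y∉ (here eq) ; (there y∈) → y∉ (there (∈-++⁺ˡ y∈)) }) y∉

-- Among the `n + 1` iterates of `x` from 0 to `n` two coincide; injectivity cancels the common
-- applications and yields a return to `x`.
cycle-from : ∀ (σ : Permutation′ n) x → ∃[ s ] Path (σ ⟨$⟩ʳ_) (σ ⟨$⟩ʳ x) s x × x ∉ s
cycle-from {n} σ x
  with p , q , p<q , eq ← Finₚ.pigeonhole ℕₚ.≤-refl (λ (k : Fin (suc n)) → iterate (σ ⟨$⟩ʳ_) x (toℕ k))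
  with k , back ← iterate-cancel (λ {y} {z} e → trans (sym (inverseˡ σ)) (trans (cong (σ ⟨$⟩ˡ_) e) (inverseˡ σ)))
                    (toℕ p) (toℕ q) p<q eq
  with s , r ← iterate-Path (σ ⟨$⟩ʳ_) x k
  with t , st ← nonempty-Path r
  with step r′ ← subst (λ w → Path (σ ⟨$⟩ʳ_) x w x) st (Path-∷ʳ r back) = first-arrival r′

-- The cycle through `x` is walked once to find its minimum `a` and then rewritten from `a`. The new
-- list is closed under `σ`, and the first walk leads from `a` back to `x`, so it contains `x`.
Cycle-through : ∀ (σ : Permutation′ n) x → Σ (Cycle σ) λ C → x ∈ Cycle.first C ∷ Cycle.rest C
Cycle-through {n} σ x
  with s , p , _ ← cycle-from σ x = record
  { first    = a
  ; rest     = r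
  ; distinct = Allₚ.¬Any⇒All¬ r a∉r ∷ Path-Unique q a∉r
  ; maps     = Path⇒maps (step q)
  ; minimal  = All.map (All.lookup a≤) (proj₁ (Path-closed (cycle-closed (step p)) q (cycle-closed (step p) a∈)))
  } , x∈
  where
  a = Extrema.min x s
  a≤ : All (a Fin.≤_) (x ∷ s)
  a≤ = Extrema.min≤⊤ x s ∷ Extrema.min≤xs x s
  a∈ : a ∈ x ∷ s
  a∈ = [ here , there ]′ (Extrema.argmin-sel (λ z → z) x s)
  cyc = cycle-from σ a
  r = proj₁ cyc
  q = proj₁ (proj₂ cyc)
  a∉r = proj₂ (proj₂ cyc)
  x∈ : x ∈ a ∷ r
  x∈ with u , v , eq ← ∈-∃++ a∈ =
    proj₂ (Path-closed {P = _∈ a ∷ r} (cycle-closed (step q))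
      (proj₂ (splitᵖ u (subst (λ w → Path (σ ⟨$⟩ʳ_) x w x) eq (step p)))) (here refl))

-- The largest element is the last letter of the cycle notation, or the fixed point itself.
Cycle⇒Top : ∀ {σ : Permutation′ n} (C : Cycle σ) → IsAndréCycle C → ∀ {x} → x ∈ Cycle.first C ∷ Cycle.rest C →
            ∃[ b ] Σ (Top (σ ⟨$⟩ʳ_) b) λ t → x ∈ word t
Cycle⇒Top {σ = σ} record { first = a ; rest = r ; distinct = a∉r ∷ _ ; maps = mp ; minimal = mn } Ar x∈
  with maps⇒Path a r mp
... | p with initLast r
...   | [] with here refl ← x∈ = a , Top-fixed (∷-injectiveˡ mp)
...   | v ∷ʳ′ k with p′ , refl ← Path-∷ʳ⁻ (a ∷ v) p = k , record
  { init       = a ∷ v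
  ; tail       = v ∷ʳ k
  ; word≡      = refl
  ; path       = p′
  ; first<tail = All.zipWith (λ (le , ne) → ℕₚ.≤∧≢⇒< le (ne ∘ Finₚ.toℕ-injective)) (mn , a∉r)
  ; andré      = Ar
  } , x∈

theorem3p4 : ∀ (n : ℕ) → 1 ≤ n → (σ : Permutation′ n) →
    IsWeb σ ⇔ (∀ (C : Cycle σ) → IsAndréCycle C)
theorem3p4 n _ σ = mk⇔
  (λ (G , r , G≈ , _) → Covered⇒André σ λ k →
    let b , t , k∈ = covered (Invariant-reachable r Invariant-initial) k
        t′ , eq    = Top-cong t λ {x} _ → G≈ x
    in b , t′ , subst (k ∈_) (sym eq) k∈)
  (λ cycles → Covered⇒IsWeb σ λ k →
    let C , k∈ = Cycle-through σ k in Cycle⇒Top C (cycles C) k∈)
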